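{- Let $F$ be a strictly finite 1-sorted species and $G=G(X,Y)$ a 2-sorted species. Then there exists a 2-sorted species $H(X,Y)$ such that $$H_{X[Y]}=F\bigl(G_{X[Y]}(-,-)\bigr),$$ i.e. there is a natural isomorphism (weight-preserving bijections, natural in both arguments) between $H_{X[Y]}(A,B)$ and $F(G_{X[Y]}(A,B))$ for $A\in\mathrm{Sets}_R$ and $B$ a finite set.
   Context: $\mathbb{B}$ is the category of finite sets and bijections; a 1-sorted species is a functor $\mathbb{B}\to\mathbb{B}$, a 2-sorted species is a functor $\mathbb{B}^2\to\mathbb{B}$. $[n]=\{1,\dots,n\}$ and $F[n]=F[[n]]$; $F$ is strictly finite if $F[n]=\emptyset$ for all sufficiently large $n$. For a commutative ring $R\supseteq\mathbb{Q}$ (with a notion of convergent infinite sums), $\mathrm{Sets}_R$ is the category of pairs $(A,w)$, $A$ a set and $w:A\to R$ a weight function such that $\sum_{a\in A}w(a)$ exists in $R$, with weight-preserving functions as morphisms; functors below are considered on those arguments for which the resulting total weights exist. For $f:[n]\to A$ put $w(f)=w(f(1))\cdots w(f(n))$. The analytic functor of a 1-sorted species $F$ is $F(A)=\sum_{n\ge0}(F[n]\times A^n)/\mathfrak{S}_n$ (disjoint union of orbit sets), where $A^n$ is the set of functions $[n]\to A$, $\sigma\cdot(t,f)=(F[\sigma](t),f\circ\sigma^{ -1})$, the orbit of $(t,f)$ has weight $w(f)$, and a morphism $g:A\to A'$ sends the orbit of $(t,f)$ to the orbit of $(t,g\circ f)$. The analytic functor in $X$ of a 2-sorted species $G$ is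 $G_{X[Y]}:\mathrm{Sets}_R\times\mathbb{B}\to\mathrm{Sets}_R$, $G_{X[Y]}(A,B)=\sum_{n\ge0}(G[n,B]\times A^n)/\mathfrak{S}_n$, with action $\sigma\cdot(t,f)=(G[\sigma,1_B](t),f\circ\sigma^{ -1})$, the orbit of $(t,f)$ having weight $w(f)$; morphisms $g:A\to A'$ act by $f\mapsto g\circ f$ and bijections of $B$ act through $G$. Equality of functors means natural isomorphism. -}

module Defs where

open import Algebra.Bundles using (CommutativeRing)
import Algebra.Properties.CommutativeMonoid.Sum as FiniteSum
open import Data.Fin.Base using (Fin)
open import Data.Nat.Base using (ℕ; _≤_)
open import Data.Product.Base using (Σ; Σ-syntax; ∃-syntax; _×_; _,_; proj₁; proj₂)
open import Function.Base using (_∘_)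
open import Function.Bundles using (Func; Inverse; _⟨$⟩_; _↔_)
import Function.Construct.Composition as Comp
import Function.Construct.Identity as Id
import Function.Construct.Symmetry as Symm
open import Level using (Level; _⊔_; 0ℓ) renaming (suc to lsuc)
open import Relation.Binary.Bundles using (Setoid)
open import Relation.Binary.Structures using (IsEquivalence)
open import Relation.Binary.PropositionalEquality.Core using (_≡_; refl; cong; subst)
import Relation.Binary.PropositionalEquality.Properties as ≡
open import Relation.Nullary.Negation.Core using (¬_)

open Setoid using (Carrier)

private
  variable
    o m e o′ m′ e′ o″ m″ e″ p q : Level

-- Hom-sets are setoids: there is no function extensionality.
record Category (o m e : Level) : Set (lsuc (o ⊔ m ⊔ e)) where
  infix  4 _≈_ _⇒_
  infixr 9 _⊙_
  field
    Obj : Set o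
    _⇒_ : Obj → Obj → Set m
    _≈_ : ∀ {X Y} → X ⇒ Y → X ⇒ Y → Set e
    id  : ∀ {X} → X ⇒ X
    _⊙_ : ∀ {X Y Z} → Y ⇒ Z → X ⇒ Y → X ⇒ Z
    equiv     : ∀ {X Y} → IsEquivalence (_≈_ {X} {Y})
    assoc     : ∀ {W X Y Z} {f : W ⇒ X} {g : X ⇒ Y} {h : Y ⇒ Z} →
                (h ⊙ g) ⊙ f ≈ h ⊙ (g ⊙ f)
    identityˡ : ∀ {X Y} {f : X ⇒ Y} → id ⊙ f ≈ f
    identityʳ : ∀ {X Y} {f : X ⇒ Y} → f ⊙ id ≈ f
    ⊙-resp-≈  : ∀ {X Y Z} {f f′ : Y ⇒ Z} {g g′ : X ⇒ Y} →
                f ≈ f′ → g ≈ g′ → f ⊙ g ≈ f′ ⊙ g′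

record Functor (C : Category o m e) (D : Category o′ m′ e′)
       : Set (o ⊔ m ⊔ e ⊔ o′ ⊔ m′ ⊔ e′) where
  private
    module C = Category C
    module D = Category D
  field
    F₀ : C.Obj → D.Obj
    F₁ : ∀ {X Y} → X C.⇒ Y → F₀ X D.⇒ F₀ Y
    identity     : ∀ {X} → F₁ (C.id {X}) D.≈ D.id
    homomorphism : ∀ {X Y Z} {f : X C.⇒ Y} {g : Y C.⇒ Z} →
                   F₁ (g C.⊙ f) D.≈ F₁ g D.⊙ F₁ f
    F-resp-≈     : ∀ {X Y} {f g : X C.⇒ Y} → f C.≈ g → F₁ f D.≈ F₁ g

module _ {C : Category o m e} {D : Category o′ m′ e′} where
  private
    module C = Category C
    module D = Category D

  record NaturalTransformation (F G : Functor C D)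
         : Set (o ⊔ m ⊔ m′ ⊔ e′) where
    private
      module F = Functor F
      module G = Functor G
    field
      η       : ∀ X → F.F₀ X D.⇒ G.F₀ X
      commute : ∀ {X Y} (f : X C.⇒ Y) → η Y D.⊙ F.F₁ f D.≈ G.F₁ f D.⊙ η X

  record NaturalIsomorphism (F G : Functor C D)
         : Set (o ⊔ m ⊔ m′ ⊔ e′) where
    private
      module F = Functor F
      module G = Functor G
    field
      to   : NaturalTransformation F G
      from : ∀ X → G.F₀ X D.⇒ F.F₀ X
      isoˡ : ∀ X → from X D.⊙ NaturalTransformation.η to X D.≈ D.id
      isoʳ : ∀ X → NaturalTransformation.η to X D.⊙ from X D.≈ D.id

  idNT : (F : Functor C D) → NaturalTransformation F F
  idNT F = record
    { η       = λ _ → D.id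
    ; commute = λ _ → IsEquivalence.trans D.equiv D.identityˡ
                        (IsEquivalence.sym D.equiv D.identityʳ)
    }

infixr 9 _∘F_
_∘F_ : {C : Category o m e} {D : Category o′ m′ e′} {E : Category o″ m″ e″} →
       Functor D E → Functor C D → Functor C E
_∘F_ {E = E} G F = record
  { F₀ = G.F₀ ∘ F.F₀
  ; F₁ = G.F₁ ∘ F.F₁
  ; identity     = trans (G.F-resp-≈ F.identity) G.identity
  ; homomorphism = trans (G.F-resp-≈ F.homomorphism) G.homomorphism
  ; F-resp-≈     = G.F-resp-≈ ∘ F.F-resp-≈
  }
  where
  module F = Functor F
  module G = Functor G
  trans : ∀ {X Y} {f g h : Category._⇒_ E X Y} →
          Category._≈_ E f g → Category._≈_ E g h → Category._≈_ E f h
  trans = IsEquivalence.trans (Category.equiv E)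

infixr 2 _×C_
_×C_ : Category o m e → Category o′ m′ e′ →
       Category (o ⊔ o′) (m ⊔ m′) (e ⊔ e′)
C ×C D = record
  { Obj = C.Obj × D.Obj
  ; _⇒_ = λ (X , Y) (X′ , Y′) → (X C.⇒ X′) × (Y D.⇒ Y′)
  ; _≈_ = λ (f , g) (f′ , g′) → (f C.≈ f′) × (g D.≈ g′)
  ; id  = C.id , D.id
  ; _⊙_ = λ (f , g) (f′ , g′) → f C.⊙ f′ , g D.⊙ g′
  ; equiv = record
    { refl  = C≈.refl , D≈.refl
    ; sym   = λ (x , y) → C≈.sym x , D≈.sym y
    ; trans = λ (x , y) (x′ , y′) → C≈.trans x x′ , D≈.trans y y′
    }
  ; assoc     = C.assoc , D.assoc
  ; identityˡ = C.identityˡ , D.identityˡ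
  ; identityʳ = C.identityʳ , D.identityʳ
  ; ⊙-resp-≈  = λ (x , y) (x′ , y′) → C.⊙-resp-≈ x x′ , D.⊙-resp-≈ y y′
  }
  where
  module C = Category C
  module D = Category D
  module C≈ {X} {Y} = IsEquivalence (C.equiv {X} {Y})
  module D≈ {X} {Y} = IsEquivalence (D.equiv {X} {Y})

FullSubcategory : (C : Category o m e) → (Category.Obj C → Set p) →
                  Category (o ⊔ p) m e
FullSubcategory C P = record
  { Obj = Σ C.Obj P
  ; _⇒_ = λ X Y → proj₁ X C.⇒ proj₁ Y
  ; _≈_ = C._≈_
  ; id  = C.id
  ; _⊙_ = C._⊙_
  ; equiv     = C.equiv
  ; assoc     = C.assoc
  ; identityˡ = C.identityˡ
  ; identityʳ = C.identityʳ
  ; ⊙-resp-≈  = C.⊙-resp-≈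
  }
  where module C = Category C

record PartialFunctor (C : Category o m e) (D : Category o′ m′ e′) (p : Level)
       : Set (o ⊔ m ⊔ e ⊔ o′ ⊔ m′ ⊔ e′ ⊔ lsuc p) where
  field
    Dom     : Category.Obj C → Set p
    functor : Functor (FullSubcategory C Dom) D

infixr 9 _∘P_
_∘P_ : {C : Category o m e} {D : Category o′ m′ e′} {E : Category o″ m″ e″} →
       PartialFunctor D E q → PartialFunctor C D p → PartialFunctor C E (p ⊔ q)
_∘P_ {C = C} {D = D} Q P = record
  { Dom     = Dom∘
  ; functor = Q.functor ∘F P↾
  }
  where
  module P = PartialFunctor P
  module Q = PartialFunctor Q
  module PF = Functor P.functor

  Dom∘ : Category.Obj C → Set _
  Dom∘ X = Σ[ d ∈ P.Dom X ] Q.Dom (PF.F₀ (X , d))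

  P↾ : Functor (FullSubcategory C Dom∘) (FullSubcategory D Q.Dom)
  P↾ = record
    { F₀ = λ (X , d , d′) → PF.F₀ (X , d) , d′
    ; F₁ = PF.F₁
    ; identity     = PF.identity
    ; homomorphism = PF.homomorphism
    ; F-resp-≈     = PF.F-resp-≈
    }

restrict : {C : Category o m e} {D : Category o′ m′ e′} →
           {P Q : Category.Obj C → Set p} → (∀ {X} → Q X → P X) →
           Functor (FullSubcategory C P) D → Functor (FullSubcategory C Q) D
restrict Q⇒P F = record
  { F₀ = λ (X , q) → F.F₀ (X , Q⇒P q)
  ; F₁ = F.F₁
  ; identity     = F.identity
  ; homomorphism = F.homomorphism
  ; F-resp-≈     = F.F-resp-≈
  }
  where module F = Functor F

-- Natural isomorphism on the arguments where both functors are defined.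
infix 4 _≅P_
_≅P_ : {C : Category o m e} {D : Category o′ m′ e′} →
       PartialFunctor C D p → PartialFunctor C D p → Set (o ⊔ m ⊔ m′ ⊔ e′ ⊔ p)
_≅P_ {C = C} {D = D} P Q =
  NaturalIsomorphism (restrict {D = D} {Q = Both} proj₁ P.functor)
                     (restrict {D = D} {Q = Both} proj₂ Q.functor)
  where
  module P = PartialFunctor P
  module Q = PartialFunctor Q
  Both : Category.Obj C → Set _
  Both X = P.Dom X × Q.Dom X

-- Sets are setoids throughout, since orbit sets are quotients. Morphisms of 𝔹
-- ignore the enumeration, so 𝔹 is equivalent to finite sets and bijections.
record FiniteSet : Set₁ where
  field
    set         : Setoid 0ℓ 0ℓ
    size        : ℕ
    enumeration : Inverse (≡.setoid (Fin size)) set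

open FiniteSet

[_] : ℕ → FiniteSet
[ n ] = record
  { set         = ≡.setoid (Fin n)
  ; size        = n
  ; enumeration = Id.inverse (≡.setoid (Fin n))
  }

𝔹 : Category (lsuc 0ℓ) 0ℓ 0ℓ
𝔹 = record
  { Obj = FiniteSet
  ; _⇒_ = λ U V → Inverse (set U) (set V)
  ; _≈_ = λ {U} {V} f g → ∀ x → Setoid._≈_ (set V) (Inverse.to f x) (Inverse.to g x)
  ; id  = λ {U} → Id.inverse (set U)
  ; _⊙_ = λ g f → Comp.inverse f g
  ; equiv = λ {U} {V} → record
    { refl  = λ _ → Setoid.refl (set V)
    ; sym   = λ p x → Setoid.sym (set V) (p x)
    ; trans = λ p q x → Setoid.trans (set V) (p x) (q x)
    }
  ; assoc     = λ {_} {_} {_} {Z} _ → Setoid.refl (set Z)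
  ; identityˡ = λ {_} {Y} _ → Setoid.refl (set Y)
  ; identityʳ = λ {_} {Y} _ → Setoid.refl (set Y)
  ; ⊙-resp-≈  = λ {_} {_} {Z} {f} {_} {_} {g′} p q x →
      Setoid.trans (set Z) (Inverse.to-cong f (q x)) (p (Inverse.to g′ x))
  }

Species : Set₁
Species = Functor 𝔹 𝔹

Species₂ : Set₁
Species₂ = Functor (𝔹 ×C 𝔹) 𝔹

StrictlyFinite : Species → Set
StrictlyFinite F = ∃[ N ] ∀ n → N ≤ n → ¬ Carrier (set (Functor.F₀ F [ n ]))

-- The 1-sorted species G[-, B], with transport G[σ, 1_B].
slice : Species₂ → FiniteSet → Species
slice G B = record
  { F₀ = λ U → G.F₀ (U , B)
  ; F₁ = λ σ → G.F₁ (σ , 𝔹.id {B})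
  ; identity     = G.identity
  ; homomorphism = λ {_} {_} {Z} {f} {g} x → Setoid.trans (set (G.F₀ (Z , B)))
      (G.F-resp-≈ ((λ _ → Setoid.refl (set Z)) , (λ _ → Setoid.refl (set B))) x)
      (G.homomorphism {f = f , 𝔹.id {B}} {g = g , 𝔹.id {B}} x)
  ; F-resp-≈     = λ p → G.F-resp-≈ (p , λ _ → Setoid.refl (set B))
  }
  where
  module G = Functor G
  module 𝔹 = Category 𝔹

-- Transport along β : B → B′, i.e. the maps G[1_U, β].
sliceMap : (G : Species₂) {B B′ : FiniteSet} → Category._⇒_ 𝔹 B B′ →
           NaturalTransformation (slice G B) (slice G B′)
sliceMap G {B} {B′} β = record
  { η       = λ U → G.F₁ (𝔹.id {U} , β)
  ; commute = λ {U} {V} f x →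
      let module S = Setoid (set (G.F₀ (V , B′))) in
      S.trans
        (S.sym (G.homomorphism {f = f , 𝔹.id {B}} {g = 𝔹.id {V} , β} x))
        (S.trans
          (G.F-resp-≈ ((λ _ → Setoid.refl (set V)) , (λ _ → Setoid.refl (set B′))) x)
          (G.homomorphism {f = 𝔹.id {U} , β} {g = f , 𝔹.id {B′}} x))
  }
  where
  module G = Functor G
  module 𝔹 = Category 𝔹

module _ {a b} (X : ℕ → Setoid a b) where

  record _≈∐_ (x y : Σ ℕ (Carrier ∘ X)) : Set b where
    constructor inj
    field
      index : proj₁ x ≡ proj₁ y
      value : Setoid._≈_ (X (proj₁ y)) (subst (Carrier ∘ X) index (proj₂ x)) (proj₂ y)

  private
    ≈∐-sym : ∀ {x y} → x ≈∐ y → y ≈∐ x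
    ≈∐-sym (inj refl p) = inj refl (Setoid.sym (X _) p)

    ≈∐-trans : ∀ {x y z} → x ≈∐ y → y ≈∐ z → x ≈∐ z
    ≈∐-trans (inj refl p) (inj refl q) = inj refl (Setoid.trans (X _) p q)

  ∐ : Setoid a b
  ∐ = record
    { Carrier = Σ ℕ (Carrier ∘ X)
    ; _≈_     = _≈∐_
    ; isEquivalence = record
      { refl  = inj refl (Setoid.refl (X _))
      ; sym   = ≈∐-sym
      ; trans = ≈∐-trans
      }
    }

-- The action of 𝔖ₙ on F[n] × Aⁿ is σ · (t , f) = (F[σ] t , f ∘ σ⁻¹).
module _ {a b} (F : Species) (A : Setoid a b) (n : ℕ) where
  private
    module F = Functor F
    module A = Setoid A
    Fn = F.F₀ [ n ]
    module Fn = Setoid (set Fn)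

  record _~_ (x y : Fn.Carrier × (Fin n → A.Carrier)) : Set b where
    constructor orbit
    field
      σ     : Fin n ↔ Fin n
      fst-≈ : Inverse.to (F.F₁ σ) (proj₁ x) Fn.≈ proj₁ y
      snd-≈ : ∀ i → proj₂ x (Inverse.from σ i) A.≈ proj₂ y i

  private
    ~-refl : ∀ {x} → x ~ x
    ~-refl = orbit (Id.inverse _) (F.identity _) (λ _ → A.refl)

    ~-sym : ∀ {x y} → x ~ y → y ~ x
    ~-sym {t , f} {t′ , f′} (orbit σ p q) = orbit (Symm.inverse σ) p′ q′
      where
      p′ : Inverse.to (F.F₁ (Symm.inverse σ)) t′ Fn.≈ t
      p′ = Fn.trans (Inverse.to-cong (F.F₁ (Symm.inverse σ)) (Fn.sym p))
             (Fn.trans (Fn.sym (F.homomorphism {f = σ} {g = Symm.inverse σ} t))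
               (Fn.trans (F.F-resp-≈ (λ i → Inverse.inverseʳ σ refl) t)
                 (F.identity t)))
      q′ : ∀ i → f′ (Inverse.to σ i) A.≈ f i
      q′ i = A.trans (A.sym (q (Inverse.to σ i)))
               (A.reflexive (cong f (Inverse.inverseʳ σ refl)))

    ~-trans : ∀ {x y z} → x ~ y → y ~ z → x ~ z
    ~-trans {t , f} (orbit σ p q) (orbit τ p′ q′) = orbit (Comp.inverse σ τ)
      (Fn.trans (F.homomorphism {f = σ} {g = τ} t)
        (Fn.trans (Inverse.to-cong (F.F₁ τ) p) p′))
      (λ i → A.trans (q (Inverse.from τ i)) (q′ i))

  Orbits : Setoid a b
  Orbits = record
    { Carrier = Fn.Carrier × (Fin n → A.Carrier)
    ; _≈_     = _~_
    ; isEquivalence = record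
      { refl  = ~-refl
      ; sym   = ~-sym
      ; trans = ~-trans
      }
    }

-- An abstract notion of (possibly infinite) convergent sums in R: HasSum A w r
-- says that the sum of w(x) over x ∈ A exists and equals r. Convergence itself
-- is left unspecified beyond these laws.
record Summation {c ℓ} (R : CommutativeRing c ℓ) (a b s : Level)
       : Set (c ⊔ ℓ ⊔ lsuc (a ⊔ b ⊔ s)) where
  private
    module R = CommutativeRing R
    module Σ+ = FiniteSum R.+-commutativeMonoid
  field
    HasSum  : (A : Setoid a b) → Func A R.setoid → R.Carrier → Set s
    resp-≈  : ∀ {A w r r′} → r R.≈ r′ → HasSum A w r → HasSum A w r′
    unique  : ∀ {A w r r′} → HasSum A w r → HasSum A w r′ → r R.≈ r′
    finite  : ∀ {n A} (w : Func A R.setoid) (e : Inverse (≡.setoid (Fin n)) A) →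
              HasSum A w (Σ+.sum λ i → w ⟨$⟩ Inverse.to e i)
    reindex : ∀ {A A′ w w′ r} (φ : Inverse A A′) →
              (∀ x → w′ ⟨$⟩ Inverse.to φ x R.≈ w ⟨$⟩ x) →
              HasSum A w r → HasSum A′ w′ r

module Analytic {c ℓ a b s} (R : CommutativeRing c ℓ) (S : Summation R a b s) where
  private
    module R = CommutativeRing R
    module Π = FiniteSum R.*-commutativeMonoid
  open Summation S

  record WeightedSet : Set (c ⊔ ℓ ⊔ lsuc (a ⊔ b)) where
    field
      underlying : Setoid a b
      weight     : Func underlying R.setoid

    w : Carrier underlying → R.Carrier
    w x = weight ⟨$⟩ x

  record WeightedMap (A A′ : WeightedSet) : Set (a ⊔ b ⊔ ℓ) where
    private
      module A  = WeightedSet A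
      module A′ = WeightedSet A′
    field
      func      : Func A.underlying A′.underlying
      preserves : ∀ x → A′.w (func ⟨$⟩ x) R.≈ A.w x

  open WeightedMap

  -- Arbitrary weight functions, no condition on the total weight.
  Weighted : Category (c ⊔ ℓ ⊔ lsuc (a ⊔ b)) (a ⊔ b ⊔ ℓ) (a ⊔ b)
  Weighted = record
    { Obj = WeightedSet
    ; _⇒_ = WeightedMap
    ; _≈_ = λ {_} {A′} g h → ∀ x → Setoid._≈_ (WeightedSet.underlying A′) (func g ⟨$⟩ x) (func h ⟨$⟩ x)
    ; id  = λ {A} → record
      { func      = Id.function (WeightedSet.underlying A)
      ; preserves = λ _ → R.refl
      }
    ; _⊙_ = λ h g → record
      { func      = Comp.function (func g) (func h)
      ; preserves = λ x → R.trans (preserves h (func g ⟨$⟩ x)) (preserves g x)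
      }
    ; equiv = λ {_} {A′} → let module A′ = Setoid (WeightedSet.underlying A′) in record
      { refl  = λ _ → A′.refl
      ; sym   = λ p x → A′.sym (p x)
      ; trans = λ p q x → A′.trans (p x) (q x)
      }
    ; assoc     = λ {_} {_} {_} {Z} _ → Setoid.refl (WeightedSet.underlying Z)
    ; identityˡ = λ {_} {Y} _ → Setoid.refl (WeightedSet.underlying Y)
    ; identityʳ = λ {_} {Y} _ → Setoid.refl (WeightedSet.underlying Y)
    ; ⊙-resp-≈  = λ {_} {_} {Z} {f} {_} {_} {g′} p q x →
        Setoid.trans (WeightedSet.underlying Z) (Func.cong (func f) (q x)) (p (func g′ ⟨$⟩ x))
    }

  Summable : WeightedSet → Set (c ⊔ s)
  Summable A = ∃[ r ] HasSum (WeightedSet.underlying A) (WeightedSet.weight A) r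

  Sets : Category (c ⊔ ℓ ⊔ s ⊔ lsuc (a ⊔ b)) (a ⊔ b ⊔ ℓ) (a ⊔ b)
  Sets = FullSubcategory Weighted Summable

  -- F(A) = ∐ₙ (F[n] × Aⁿ)/𝔖ₙ, where the orbit of (t , f) has weight ∏ᵢ w(f i).
  analytic₀ : Species → WeightedSet → WeightedSet
  analytic₀ F A = record
    { underlying = ∐ (Orbits F A.underlying)
    ; weight     = record
      { to   = λ (_ , _ , f) → Π.sum (A.w ∘ f)
      ; cong = w-cong
      }
    }
    where
    module A = WeightedSet A
    w-cong : ∀ {x y} → Setoid._≈_ (∐ (Orbits F A.underlying)) x y →
             Π.sum (A.w ∘ proj₂ (proj₂ x)) R.≈ Π.sum (A.w ∘ proj₂ (proj₂ y))
    w-cong {_ , _ , f} (inj refl (orbit σ _ q)) =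
      R.trans (Π.sum-permute (A.w ∘ f) (Symm.inverse σ))
              (Π.sum-cong-≋ (λ i → Func.cong A.weight (q i)))

  -- (t , f) ↦ (α t , g ∘ f)
  analytic₁ : ∀ {F F′ A A′} → NaturalTransformation F F′ → WeightedMap A A′ →
              WeightedMap (analytic₀ F A) (analytic₀ F′ A′)
  analytic₁ {F} {F′} {A} {A′} α g = record
    { func = record
      { to   = λ (n , t , f) → n , Inverse.to (α.η [ n ]) t , λ i → func g ⟨$⟩ f i
      ; cong = λ { {_ , t , _} (inj refl (orbit σ p q)) → inj refl (orbit σ
                   (Setoid.trans (set (Functor.F₀ F′ [ _ ]))
                     (Setoid.sym (set (Functor.F₀ F′ [ _ ])) (α.commute σ t))
                     (Inverse.to-cong (α.η [ _ ]) p))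
                   (λ i → Func.cong (func g) (q i))) }
      }
    ; preserves = λ (_ , _ , f) → Π.sum-cong-≋ (λ i → preserves g (f i))
    }
    where module α = NaturalTransformation α

  private
    same-orbit : ∀ {F A n} {t t′ : Carrier (set (Functor.F₀ F [ n ]))}
                 {f f′ : Fin n → Carrier (WeightedSet.underlying A)} →
                 Setoid._≈_ (set (Functor.F₀ F [ n ])) t t′ →
                 (∀ i → Setoid._≈_ (WeightedSet.underlying A) (f i) (f′ i)) →
                 Setoid._≈_ (WeightedSet.underlying (analytic₀ F A)) (n , t , f) (n , t′ , f′)
    same-orbit {F} {n = n} {t} p q =
      inj refl (orbit (Id.inverse _) (Setoid.trans (set (F.F₀ [ n ])) (F.identity t) p) q)
      where module F = Functor F

  analyticFunctor : Species → Functor Weighted Weighted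
  analyticFunctor F = record
    { F₀ = analytic₀ F
    ; F₁ = analytic₁ (idNT F)
    ; identity     = λ {A} _ → Setoid.refl (WeightedSet.underlying (analytic₀ F A))
    ; homomorphism = λ {_} {_} {A} _ → Setoid.refl (WeightedSet.underlying (analytic₀ F A))
    ; F-resp-≈     = λ {_} {A} p (n , _ , f) →
        same-orbit {F} {A} (Setoid.refl (set (Functor.F₀ F [ n ]))) (p ∘ f)
    }

  -- G_{X[Y]}(A, B) = ∐ₙ (G[n, B] × Aⁿ)/𝔖ₙ is G[-, B] evaluated at A.
  analyticFunctorX : Species₂ → Functor (Weighted ×C 𝔹) Weighted
  analyticFunctorX G = record
    { F₀ = λ (A , B) → analytic₀ (slice G B) A
    ; F₁ = λ (g , β) → analytic₁ (sliceMap G β) g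
    ; identity     = λ {(A , B)} (n , t , f) →
        same-orbit {slice G B} {A} (G.identity t) (λ _ → Setoid.refl (WeightedSet.underlying A))
    ; homomorphism = λ {_} {_} {(A″ , B″)} {(g , β)} {(g′ , β′)} (n , t , f) →
        same-orbit {slice G B″} {A″}
          (Setoid.trans (set (G.F₀ ([ n ] , B″)))
            (G.F-resp-≈ ((λ _ → refl) , (λ _ → Setoid.refl (set B″))) t)
            (G.homomorphism {f = Id.inverse _ , β} {g = Id.inverse _ , β′} t))
          (λ _ → Setoid.refl (WeightedSet.underlying A″))
    ; F-resp-≈     = λ {_} {(A′ , B′)} (p , q) (n , t , f) →
        same-orbit {slice G B′} {A′} (G.F-resp-≈ ((λ _ → refl) , q) t) (p ∘ f)
    }
    where module G = Functor G

  -- The analytic functors on Sets, defined where the total weight exists.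
  _⟨-⟩ : Species → PartialFunctor Sets Sets (c ⊔ s)
  F ⟨-⟩ = record
    { Dom     = λ (A , _) → Summable (F̂.F₀ A)
    ; functor = record
      { F₀ = λ ((A , _) , d) → F̂.F₀ A , d
      ; F₁ = F̂.F₁
      ; identity     = λ {((A , _) , _)} → F̂.identity {A}
      ; homomorphism = λ {_} {_} {_} {f} {g} → F̂.homomorphism {f = f} {g = g}
      ; F-resp-≈     = λ {_} {_} {f} {g} → F̂.F-resp-≈ {f = f} {g = g}
      }
    }
    where module F̂ = Functor (analyticFunctor F)

  _X[Y] : Species₂ → PartialFunctor (Sets ×C 𝔹) Sets (c ⊔ s)
  G X[Y] = record
    { Dom     = λ ((A , _) , B) → Summable (Ĝ.F₀ (A , B))
    ; functor = record
      { F₀ = λ (((A , _) , B) , d) → Ĝ.F₀ (A , B) , d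
      ; F₁ = Ĝ.F₁
      ; identity     = λ {(((A , _) , B) , _)} → Ĝ.identity {A , B}
      ; homomorphism = λ {_} {_} {_} {f} {g} → Ĝ.homomorphism {f = f} {g = g}
      ; F-resp-≈     = λ {_} {_} {f} {g} → Ĝ.F-resp-≈ {f = f} {g = g}
      }
    }
    where module Ĝ = Functor (analyticFunctorX G)

{-# OPTIONS --safe #-}
-- H[U, B] consists of the elements of F(G_{X[Y]}(U, B)) that use every label u ∈ U
-- exactly once, so that H inherits its transport from the functor F(G_{X[Y]}(-, -)).
-- It is finite because F-structures have bounded size (F is strictly finite) and the
-- G-structures in a linear element have at most |U| labels. An element of
-- H_{X[Y]}(A, B) is a linear element over [n] together with f : [n] → A, and replacing
-- each label i by f(i) is the isomorphism: every element of F(G_{X[Y]}(A, B)) arises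
-- by first giving its labelled positions distinct names, uniquely up to renaming.
module Submission where

open import Defs
open import Algebra.Bundles using (CommutativeMonoid; CommutativeRing)
open import Algebra.Morphism.Structures using (IsRingMonomorphism)
import Algebra.Properties.CommutativeMonoid.Sum as FiniteSum
open import Data.Fin.Base using (Fin; zero; suc; _↑ˡ_; _↑ʳ_)
open import Data.Fin.Permutation using (↔⇒≡)
import Data.Fin.Properties as Fin
open import Data.List.Base
  using (List; []; _∷_; map; mapMaybe; concatMap; upTo; allFin; cartesianProduct;
         cartesianProductWith; deduplicate; length; lookup)
open import Data.List.Membership.Propositional.Properties using (∈-upTo⁺; ∈-allFin; ∈-lookup)
import Data.List.Membership.Setoid as SetoidMembership
open import Data.List.Relation.Unary.All as All using (_∷_)
open import Data.List.Relation.Unary.AllPairs using (_∷_)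
open import Data.List.Relation.Unary.Any as Any using (Any; here; any?; satisfied)
import Data.List.Relation.Unary.Any.Properties as Any
open import Data.List.Relation.Unary.Enumerates.Setoid using (IsEnumeration)
open import Data.List.Relation.Unary.Enumerates.Setoid.Properties
  using (deduplicate⁺; lookup-surjective)
open import Data.List.Relation.Unary.Unique.DecSetoid.Properties using (deduplicate-!)
open import Data.List.Relation.Unary.Unique.Setoid using (Unique)
open import Data.Maybe.Base using (Maybe; just; nothing)
import Data.Maybe.Relation.Unary.Any as Maybe
open import Data.Nat.Base as ℕ using (ℕ; zero; suc; _<_; s≤s)
import Data.Nat.Properties as ℕ
open import Data.Product.Base using (Σ; Σ-syntax; ∃; _×_; _,_; proj₁; proj₂)
open import Data.Product.Function.Dependent.Propositional using (Σ-↔)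
open import Data.Product.Properties.WithK using (,-injectiveʳ)
open import Data.Rational.Base using (ℚ; +-*-rawRing)
open import Data.Sum.Base using (_⊎_; inj₁; inj₂)
open import Data.Sum.Function.Propositional using (_⊎-↔_)
open import Data.Vec.Functional as Vector using (Vector)
open import Data.Vec.Functional.Relation.Binary.Equality.Setoid using (≋-setoid)
open import Function.Base using (_∘_; id)
open import Function.Bundles
  using (Func; Inverse; Injection; Bijection; _⟨$⟩_; _↔_; _⇔_; mk⇔; mk↔ₛ′)
open import Function.Consequences.Setoid using (strictlySurjective⇒surjective)
import Function.Construct.Composition as Comp
import Function.Construct.Identity as Id
open import Function.Construct.Identity using (↔-id)
import Function.Construct.Symmetry as Symm
open import Function.Definitions using (Injective; Bijective)
open import Function.Properties.Bijection using (Bijection⇒Inverse)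
open import Function.Properties.Inverse using (↔⇒↣; toFunction; fromFunction; Inverse⇒Bijection)
open import Level using (Level; 0ℓ)
open import Relation.Binary.Bundles using (Setoid; DecSetoid)
import Relation.Binary.Construct.On as On
open import Relation.Binary.Definitions using (Decidable)
open import Relation.Binary.PropositionalEquality using (_≡_; refl; sym; trans; cong; _≗_)
import Relation.Binary.PropositionalEquality.Properties as ≡
open import Relation.Nullary.Decidable using (Dec; yes; no; map′; _×-dec_; _→-dec_)
open import Relation.Nullary.Negation using (contradiction)

open Setoid using (Carrier)
open FiniteSet

private
  variable
    a b c a′ b′ a″ b″ p q ℓ : Level
    I J : Set a

-- Finiteness and decidability of orbit sets

module _ {X : Set a} {Q : X → Set q} (Q? : ∀ x → Dec (Q x)) where

  private
    witness : X → Maybe (Σ X Q)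
    witness x with Q? x
    ... | yes y = just (x , y)
    ... | no  _ = nothing

    witness⁺ : {P : X → Set p} → ∀ {x} → Q x × P x → Maybe.Any (P ∘ proj₁) (witness x)
    witness⁺ {x = x} (y , z) with Q? x
    ... | yes _ = Maybe.just z
    ... | no ¬y = contradiction y ¬y

  witnesses : List X → List (Σ X Q)
  witnesses = mapMaybe witness

  -- `P` looks only at the first component, because the proof of `Q` kept in the list is the one
  -- found by `Q?`, not the one supplied.
  witnesses⁺ : {P : X → Set p} → ∀ {xs} → Any (λ x → Q x × P x) xs →
               Any (P ∘ proj₁) (witnesses xs)
  witnesses⁺ {xs = xs} = Any.mapMaybe⁺ witness xs ∘ Any.gmap witness⁺

functions : {X : Set a} → List X → ∀ n → List (Vector X n)
functions xs zero    = Vector.[] ∷ []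
functions xs (suc n) = cartesianProductWith Vector._∷_ xs (functions xs n)

module _ (S : Setoid a ℓ) where
  open SetoidMembership S using (_∈_)

  ∈-functions : ∀ {xs} n {f : Vector (Carrier S) n} → (∀ i → f i ∈ xs) →
                SetoidMembership._∈_ (≋-setoid S n) f (functions xs n)
  ∈-functions zero    _ = here λ ()
  ∈-functions (suc n) p = Any.cartesianProductWith⁺ Vector._∷_
    (λ { x y zero → x ; x y (suc i) → y i }) (p zero) (∈-functions n (p ∘ suc))

  lookup-injective : ∀ {xs} → Unique S xs → Injective _≡_ (Setoid._≈_ S) (lookup xs)
  lookup-injective (_ ∷ _)  {zero}  {zero}  _ = refl
  lookup-injective (p ∷ _)  {zero}  {suc j} q = contradiction q (All.lookup p (∈-lookup j))
  lookup-injective (p ∷ _)  {suc i} {zero}  q = contradiction (Setoid.sym S q) (All.lookup p (∈-lookup i))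
  lookup-injective (_ ∷ ps) {suc i} {suc j} q = cong suc (lookup-injective ps q)

-- An enumeration may list an element several times; deduplication makes `lookup` injective and
-- keeps it surjective.
isEnumeration⇒Inverse : (S : DecSetoid a ℓ) → let open DecSetoid S in ∀ {xs} →
  IsEnumeration setoid xs →
  Inverse (≡.setoid (Fin (length (deduplicate _≟_ xs)))) setoid
isEnumeration⇒Inverse S {xs} e = Bijection⇒Inverse record
  { to        = lookup (deduplicate _≟_ xs)
  ; cong      = λ { refl → S.refl }
  ; bijective = lookup-injective setoid (deduplicate-! S xs) , lookup-surjective setoid (deduplicate⁺ S e)
  }
  where
  module S = DecSetoid S
  open S

-- The search runs over pairs of functions, since being mutually inverse is decidable for a pair and
-- both directions of σ occur in `_~_`.
permutations : ∀ n → List (Fin n ↔ Fin n)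
permutations n = map (λ ((f , g) , fg , gf) → mk↔ₛ′ f g fg gf) (witnesses
  (λ (f , g) → Fin.all? (λ i → f (g i) Fin.≟ i) ×-dec Fin.all? (λ i → g (f i) Fin.≟ i))
  (cartesianProduct (functions (allFin n) n) (functions (allFin n) n)))

∈-permutations : ∀ {n} (σ : Fin n ↔ Fin n) →
  Any (λ τ → Inverse.to σ ≗ Inverse.to τ × Inverse.from σ ≗ Inverse.from τ) (permutations n)
∈-permutations {n} σ = Any.map⁺ (witnesses⁺ _ (Any.map inverse (Any.cartesianProduct⁺
  (∈-functions (≡.setoid (Fin n)) n {σ.to} (∈-allFin ∘ σ.to))
  (∈-functions (≡.setoid (Fin n)) n {σ.from} (∈-allFin ∘ σ.from)))))
  where
  module σ = Inverse σ
  inverse : ∀ {((f , g)) : Vector (Fin n) n × Vector (Fin n) n} →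
            σ.to ≗ f × σ.from ≗ g → ((f ∘ g ≗ id) × (g ∘ f ≗ id)) × σ.to ≗ f × σ.from ≗ g
  inverse {f , g} (p , q) =
    ( (λ i → trans (sym (p (g i))) (σ.inverseˡ (sym (q i))))
    , (λ i → trans (sym (q (f i))) (σ.inverseʳ (sym (p i)))))
    , p , q

≈-decidable : (U : FiniteSet) → Decidable (Setoid._≈_ (set U))
≈-decidable U x y = map′
  (λ p → U.trans (U.sym (e.strictlyInverseˡ x)) (U.trans (e.to-cong p) (e.strictlyInverseˡ y)))
  e.from-cong
  (e.from x Fin.≟ e.from y)
  where
  module U = Setoid (set U)
  module e = Inverse (enumeration U)

elements : (U : FiniteSet) → List (Carrier (set U))
elements U = map (Inverse.to (enumeration U)) (allFin (size U))

∈-elements : ∀ U → IsEnumeration (set U) (elements U)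
∈-elements U x = Any.map⁺
  (Any.map (λ p → Setoid.sym (set U) (e.inverseˡ (sym p))) (∈-allFin (e.from x)))
  where module e = Inverse (enumeration U)

module _ (F : Species) (A : Setoid a ℓ) where
  private
    module F = Functor F
    module A = Setoid A

  open SetoidMembership

  -- Orbit equality is an existential over permutations, hence a finite search. The witness σ need
  -- not be listed itself, but a pointwise equal permutation is, and it acts in the same way.
  ~-decidable : Decidable A._≈_ → ∀ n → Decidable (_~_ F A n)
  ~-decidable _≟_ n (t , f) (t′ , f′) = map′
    (λ r → let σ , p , q = satisfied {P = Relates} r in orbit σ p q)
    (λ (orbit σ p q) → Any.map (λ {τ} (σ≗τ , σ⁻¹≗τ⁻¹) →
        Fn.trans (Fn.sym (F.F-resp-≈ {f = σ} {g = τ} σ≗τ t)) p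
      , λ i → A.trans (A.reflexive (cong f (sym (σ⁻¹≗τ⁻¹ i)))) (q i)) (∈-permutations σ))
    (any? (λ σ → ≈-decidable (F.F₀ [ n ]) (Inverse.to (F.F₁ σ) t) t′
                 ×-dec Fin.all? (λ i → f (Inverse.from σ i) ≟ f′ i))
          (permutations n))
    where
    module Fn = Setoid (set (F.F₀ [ n ]))
    Relates : Fin n ↔ Fin n → Set _
    Relates σ = Inverse.to (F.F₁ σ) t Fn.≈ t′ × ∀ i → f (Inverse.from σ i) A.≈ f′ i

  analytic-decidable : Decidable A._≈_ → Decidable (_≈∐_ (Orbits F A))
  analytic-decidable _≟_ (m , x) (n , y) with m ℕ.≟ n
  ... | no m≢n   = no (m≢n ∘ _≈∐_.index)
  ... | yes refl = map′ (inj refl) (λ { (inj refl p) → p }) (~-decidable _≟_ n x y)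

  -- An orbit may be listed through several representatives; `isEnumeration⇒Inverse` removes the
  -- repetitions.
  analyticElements : ℕ → List (Carrier A) → List (Carrier (∐ (Orbits F A)))
  analyticElements N xs = concatMap
    (λ n → map (n ,_) (cartesianProduct (elements (F.F₀ [ n ])) (functions xs n)))
    (upTo N)

  ∈-analyticElements : ∀ {N xs n t f} → n < N → (∀ i → _∈_ A (f i) xs) →
                       _∈_ (∐ (Orbits F A)) (n , t , f) (analyticElements N xs)
  ∈-analyticElements {n = n} {t} {f} n<N f∈xs = Any.concatMap⁺ _ (Any.map
    (λ { refl → Any.map⁺ (Any.map
      (λ {(t′ , f′)} (p , q) → inj refl (orbit (↔-id _) (Fn.trans (F.identity t) p) q))
      (Any.cartesianProduct⁺ (∈-elements (F.F₀ [ n ]) t) (∈-functions A n f∈xs))) })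
    (∈-upTo⁺ n<N))
    where module Fn = Setoid (set (F.F₀ [ n ]))

-- Labelled positions and the composite of two analytic functors

module _ (S : Setoid a ℓ) where
  open Setoid S renaming (refl to ≈-refl; sym to ≈-sym; trans to ≈-trans)

  -- Serves both to carry linearity between equal elements and to replace a type of positions by
  -- some `Fin m`.
  bijective-reindex : {f : I → Carrier S} {g : J → Carrier S} (κ : J ↔ I) →
                      (∀ j → f (Inverse.to κ j) ≈ g j) →
                      Bijective _≡_ _≈_ f → Bijective _≡_ _≈_ g
  bijective-reindex {f = f} {g} κ fκ≈g (injective , surjective) =
      (λ gj≈gj′ → Injection.injective (↔⇒↣ κ) (injective (≈-trans (fκ≈g _) (≈-trans gj≈gj′ (≈-sym (fκ≈g _))))))
    , λ x → let i , fi≈x = surjective x in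
        Inverse.from κ i , λ { refl → ≈-trans (≈-sym (fκ≈g _)) (fi≈x (Inverse.strictlyInverseˡ κ i)) }

-- Surjectivity need only be tested on the enumerated elements, so both halves are finite searches
-- over `Fin`.
bijective? : (U : FiniteSet) → ∀ {m} (f : Fin m → Carrier (set U)) →
             Dec (Bijective _≡_ (Setoid._≈_ (set U)) f)
bijective? U {m} f = map′ {A = OneOne × Onto}
  (λ (one-one , onto) → (λ {i} {j} → one-one i j) , λ x →
    let i , fi≈x = onto (e.from x) in
    i , λ { refl → U.trans fi≈x (e.strictlyInverseˡ x) })
  (λ (one-one , onto) → (λ i j → one-one) , λ u → let i , fi≈u = onto (e.to u) in i , fi≈u refl)
  (injective? ×-dec surjective?)
  where
  module U = Setoid (set U)
  module e = Inverse (enumeration U)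

  OneOne = ∀ i j → f i U.≈ f j → i ≡ j
  Onto = ∀ u → ∃ λ i → f i U.≈ e.to u

  injective? : Dec OneOne
  injective? = Fin.all? λ i → Fin.all? λ j → ≈-decidable U (f i) (f j) →-dec (i Fin.≟ j)

  surjective? : Dec Onto
  surjective? = Fin.all? λ u → Fin.any? λ i → ≈-decidable U (f i) (e.to u)

total : ∀ {k} → Vector ℕ k → ℕ
total = Vector.foldr ℕ._+_ 0

Σ-suc↔⊎ : ∀ {k} {P : Fin (suc k) → Set a} → (P zero ⊎ Σ (Fin k) (P ∘ suc)) ↔ Σ (Fin (suc k)) P
Σ-suc↔⊎ = mk↔ₛ′
  (λ { (inj₁ x) → zero , x ; (inj₂ (i , x)) → suc i , x })
  (λ { (zero , x) → inj₁ x ; (suc i , x) → inj₂ (i , x) })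
  (λ { (zero , x) → refl ; (suc i , x) → refl })
  (λ { (inj₁ x) → refl ; (inj₂ (i , x)) → refl })

-- Numbers the positions block after block.
flatten : ∀ {k} (n : Vector ℕ k) → Fin (total n) ↔ Σ (Fin k) (Fin ∘ n)
flatten {zero}  n = mk↔ₛ′ (λ ()) (λ ()) (λ ()) (λ ())
flatten {suc k} n = Comp.inverse Fin.+↔⊎
  (Comp.inverse (↔-id _ ⊎-↔ flatten (n ∘ suc)) Σ-suc↔⊎)

-- The weight-free form of `analytic₁`. The levels of the two label sets are independent, so that
-- finite label sets can be mapped into an arbitrary `A`.
analyticMap : ∀ {F F′} {A : Setoid a b} {A′ : Setoid a′ b′} →
              NaturalTransformation F F′ → Func A A′ → Func (∐ (Orbits F A)) (∐ (Orbits F′ A′))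
analyticMap {F′ = F′} α g = record
  { to   = λ (n , t , f) → n , Inverse.to (α.η [ n ]) t , λ i → g ⟨$⟩ f i
  ; cong = λ { {n , t , _} (inj refl (orbit σ p q)) → inj refl (orbit σ
      (Setoid.trans (set (Functor.F₀ F′ [ n ]))
        (Setoid.sym (set (Functor.F₀ F′ [ n ])) (α.commute σ t))
        (Inverse.to-cong (α.η [ n ]) p))
      (λ i → Func.cong g (q i))) }
  }
  where module α = NaturalTransformation α

module _ (F : Species) (A : Setoid a b) where
  private
    module F = Functor F
    module A = Setoid A

  -- A bijection between `Fin m` and `Fin n` forces m = n. Allowing two different degrees here keeps
  -- `subst` out of all later equalities.
  relabel : ∀ {m n t t′ f f′} (σ : Fin m ↔ Fin n) →
            Setoid._≈_ (set (F.F₀ [ n ])) (Inverse.to (F.F₁ σ) t) t′ →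
            (∀ i → f (Inverse.from σ i) A.≈ f′ i) →
            _≈∐_ (Orbits F A) (m , t , f) (n , t′ , f′)
  relabel σ with refl ← ↔⇒≡ σ = λ p q → inj refl (orbit σ p q)

  relabelling : ∀ {m n t t′ f f′} → _≈∐_ (Orbits F A) (m , t , f) (n , t′ , f′) →
    Σ[ σ ∈ Fin m ↔ Fin n ] Setoid._≈_ (set (F.F₀ [ n ])) (Inverse.to (F.F₁ σ) t) t′
                           × (∀ i → f (Inverse.from σ i) A.≈ f′ i)
  relabelling (inj refl (orbit σ p q)) = σ , p , q

  pointwise : ∀ {n t t′ f f′} → Setoid._≈_ (set (F.F₀ [ n ])) t t′ → (∀ i → f i A.≈ f′ i) →
              _≈∐_ (Orbits F A) (n , t , f) (n , t′ , f′)
  pointwise {n} {t} p = relabel (↔-id _) (Setoid.trans (set (F.F₀ [ n ])) (F.identity t) p)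

module _ {T S : ℕ → Set} {X : Set a} where

  -- An occurrence of a label: an index of the outer structure, then an index of the inner structure
  -- sitting there. `T` and `S` stand for the structures themselves, which do not affect positions.
  Position : Σ[ k ∈ ℕ ] T k × Vector (Σ[ n ∈ ℕ ] S n × Vector X n) k → Set
  Position (k , _ , f) = Σ[ i ∈ Fin k ] Fin (proj₁ (f i))

  label : ∀ x → Position x → X
  label (_ , _ , f) (i , j) = proj₂ (proj₂ (f i)) j

module Composite (F : Species) (G : Species₂) where
  private
    module F = Functor F
    module G = Functor G
    open Category 𝔹 using (_⇒_) renaming (id to 1ᴮ; _⊙_ to _⊙ᴮ_; _≈_ to _≈ᴮ_)

  Inner : Setoid a b → FiniteSet → Setoid a b
  Inner A B = ∐ (Orbits (slice G B) A)

  -- The underlying set of F(G_{X[Y]}(A, B)), with weights and summability set aside.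
  Outer : Setoid a b → FiniteSet → Setoid a b
  Outer A B = ∐ (Orbits F (Inner A B))

  module _ {A : Setoid a b} {A′ : Setoid a′ b′} (B B′ : FiniteSet) where

    inner₁ : Func A A′ → B ⇒ B′ → Func (Inner A B) (Inner A′ B′)
    inner₁ g β = analyticMap (sliceMap G {B} {B′} β) g

    outer₁ : Func A A′ → B ⇒ B′ → Func (Outer A B) (Outer A′ B′)
    outer₁ g β = analyticMap (idNT F) (inner₁ g β)

    -- This and the next two lemmas are the functor laws of F(G_{X[Y]}(-, -)) on bare setoids. In
    -- each, identity permutations witness the equality of orbits.
    outer₁-cong : (g g′ : Func A A′) (β β′ : B ⇒ B′) →
      (∀ x → Setoid._≈_ A′ (g ⟨$⟩ x) (g′ ⟨$⟩ x)) → _≈ᴮ_ {B} {B′} β β′ →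
      ∀ x → Setoid._≈_ (Outer A′ B′) (outer₁ g β ⟨$⟩ x) (outer₁ g′ β′ ⟨$⟩ x)
    outer₁-cong _ _ _ _ p q (k , t , f) = pointwise F _ (Setoid.refl (set (F.F₀ [ k ])))
      λ i → let n , s , l = f i in
        pointwise (slice G B′) A′ (G.F-resp-≈ ((λ _ → refl) , q) s) (p ∘ l)

  outer₁-id : (A : Setoid a b) (B : FiniteSet) → ∀ x →
    Setoid._≈_ (Outer A B) (outer₁ B B (Id.function A) (1ᴮ {B}) ⟨$⟩ x) x
  outer₁-id A B (k , t , f) = pointwise F _ (Setoid.refl (set (F.F₀ [ k ])))
    λ i → let n , s , l = f i in pointwise (slice G B) A (G.identity s) (λ _ → Setoid.refl A)

  outer₁-∘ : {A : Setoid a b} {A′ : Setoid a′ b′} {A″ : Setoid a″ b″} (B B′ B″ : FiniteSet)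
    (g : Func A A′) (g′ : Func A′ A″) (β : B ⇒ B′) (β′ : B′ ⇒ B″) → ∀ x →
    Setoid._≈_ (Outer A″ B″)
      (outer₁ B B″ (Comp.function g g′) (_⊙ᴮ_ {B} {B′} {B″} β′ β) ⟨$⟩ x)
      (outer₁ B′ B″ g′ β′ ⟨$⟩ (outer₁ B B′ g β ⟨$⟩ x))
  outer₁-∘ {A″ = A″} B B′ B″ g g′ β β′ (k , t , f) = pointwise F _ (Setoid.refl (set (F.F₀ [ k ])))
    λ i → let n , s , l = f i in pointwise (slice G B″) A″
      (Setoid.trans (set (G.F₀ ([ n ] , B″)))
        (G.F-resp-≈ ((λ _ → refl) , (λ _ → Setoid.refl (set B″))) s)
        (G.homomorphism {f = Id.inverse _ , β} {g = Id.inverse _ , β′} s))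
      (λ _ → Setoid.refl A″)

  labelled : (B : FiniteSet) {A : Setoid a b} {A′ : Setoid a′ b′} →
             Func A A′ → Func (Outer A B) (Outer A′ B)
  labelled B g = outer₁ B B g (1ᴮ {B})

  -- Equality in Outer sees the labels only through their values, so an equality
  -- transfers along κ to any labellings that agree on corresponding positions.
  match : (B : FiniteSet) {U V : Setoid 0ℓ 0ℓ} {A : Setoid a b} (c : Func U A) (d : Func V A) →
    ∀ {x y} →
    Setoid._≈_ (Outer A B) (labelled B c ⟨$⟩ x) (labelled B d ⟨$⟩ y) →
    Σ[ κ ∈ Position y ↔ Position x ]
      (∀ q → Setoid._≈_ A (c ⟨$⟩ label x (Inverse.to κ q)) (d ⟨$⟩ label y q))
      × (∀ {W : Setoid 0ℓ 0ℓ} (c′ : Func U W) (d′ : Func V W) →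
         (∀ q → Setoid._≈_ W (c′ ⟨$⟩ label x (Inverse.to κ q)) (d′ ⟨$⟩ label y q)) →
         Setoid._≈_ (Outer W B) (labelled B c′ ⟨$⟩ x) (labelled B d′ ⟨$⟩ y))
  match B {A = A} c d {k , t , f} {_ , t′ , f′} (inj refl (orbit σ p q)) =
      Σ-↔ (Symm.inverse σ) (λ {i} → Symm.inverse (proj₁ (τ i)))
    , (λ (i , j) → proj₂ (proj₂ (τ i)) j)
    , λ {W} c′ d′ agree → inj refl (orbit σ p λ i →
        relabel (slice G B) W (proj₁ (τ i)) (proj₁ (proj₂ (τ i))) (λ j → agree (i , j)))
    where τ = λ i → relabelling (slice G B) A (q i)

-- Iterated sums in a commutative monoid

module _ (M : CommutativeMonoid c ℓ) where
  open CommutativeMonoid M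
    renaming (_∙_ to _+_; Carrier to X; refl to ≈-refl; sym to ≈-sym; trans to ≈-trans)
  open FiniteSum M using (sum; sum-cong-≋; sum-permute)

  sum-+ : ∀ m {n} (f : Vector X (m ℕ.+ n)) → sum f ≈ sum (f ∘ (_↑ˡ n)) + sum (f ∘ (m ↑ʳ_))
  sum-+ zero    f = ≈-sym (identityˡ _)
  sum-+ (suc m) f = ≈-trans (∙-congˡ (sum-+ m (f ∘ suc))) (≈-sym (assoc _ _ _))

  -- Induction on the number of blocks: `sum-+` splits off the first block, and the `splitAt` inside
  -- `flatten` then computes on each part.
  sum-flatten : ∀ {k} (n : Vector ℕ k) (f : Σ (Fin k) (Fin ∘ n) → X) →
                sum (λ i → sum (λ j → f (i , j))) ≈ sum (f ∘ Inverse.to (flatten n))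
  sum-flatten {zero}  n f = ≈-refl
  sum-flatten {suc k} n f = ≈-sym (≈-trans (sum-+ (n zero) _) (∙-cong
    (sum-cong-≋ λ j → reflexive (cong (f ∘ rest) (Fin.splitAt-↑ˡ (n zero) j _)))
    (≈-trans
      (sum-cong-≋ λ j → reflexive (cong (f ∘ rest) (Fin.splitAt-↑ʳ (n zero) _ j)))
      (≈-sym (sum-flatten (n ∘ suc) (λ (i , j) → f (suc i , j)))))))
    where rest = Inverse.to (Comp.inverse (↔-id _ ⊎-↔ flatten (n ∘ suc)) Σ-suc↔⊎)

  -- Read in the multiplicative monoid of R, this turns the product of products that weighs a
  -- composite element into a single product over labels.
  sum-reindex : ∀ {k m} (n : Vector ℕ k) (l : Σ (Fin k) (Fin ∘ n) ↔ Fin m) (f : Vector X m) →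
                sum (λ i → sum (λ j → f (Inverse.to l (i , j)))) ≈ sum f
  sum-reindex n l f = ≈-trans (sum-flatten n (f ∘ Inverse.to l))
    (≈-sym (sum-permute f (Comp.inverse (flatten n) l)))

-- The substituted species and its evaluation

module Substitution (F : Species) (strictlyFinite : StrictlyFinite F) (G : Species₂) where
  open Composite F G
  private
    module F = Functor F
    module G = Functor G
    module 𝔹 = Category 𝔹
    N = proj₁ strictlyFinite
    1ᴮ : ∀ {B} → B 𝔹.⇒ B
    1ᴮ {B} = 𝔹.id {B}

  Linear : (A : Setoid a b) (B : FiniteSet) → Carrier (Outer A B) → Set _
  Linear A B x = Bijective _≡_ (Setoid._≈_ A) (label x)

  module _ (U B : FiniteSet) where
    private module Outer = Setoid (Outer (set U) B)
    open SetoidMembership (Outer (set U) B) using (_∈_)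

    -- Equal elements have positions in a label-preserving bijection, obtained from `match` with
    -- identity labellings on both sides.
    linear-resp-≈ : ∀ {x y} → x Outer.≈ y → Linear (set U) B x → Linear (set U) B y
    linear-resp-≈ x≈y = bijective-reindex (set U) κ agree
      where
      1ᵁ = Id.function (set U)
      matching = match B 1ᵁ 1ᵁ (Func.cong (labelled B 1ᵁ) x≈y)
      κ        = proj₁ matching
      agree    = proj₁ (proj₂ matching)

    linear? : ∀ x → Dec (Linear (set U) B x)
    linear? x@(_ , _ , f) = map′
      (bijective-reindex (set U) (Symm.inverse positions)
        (λ p → Setoid.reflexive (set U) (cong (label x) (Inverse.strictlyInverseˡ positions p))))
      (bijective-reindex (set U) positions (λ _ → Setoid.refl (set U)))
      (bijective? U (label x ∘ Inverse.to positions))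
      where positions = flatten (proj₁ ∘ f)

    -- Both degree bounds are strict: the outer degree is below `N`, while an inner degree may equal
    -- `size U`, hence the `suc`.
    candidates : List Outer.Carrier
    candidates = analyticElements F (Inner (set U) B) N
      (analyticElements (slice G B) (set U) (suc (size U)) (elements U))

    -- An F-structure of size at least `N` cannot exist, and the labels within one inner structure
    -- are distinct elements of `U`.
    linear⇒∈-candidates : ∀ {x} → Linear (set U) B x → x ∈ candidates
    linear⇒∈-candidates {k , t , f} (one-one , _) =
      ∈-analyticElements F _ (ℕ.≰⇒> λ N≤k → proj₂ strictlyFinite k N≤k t) λ i →
        let n , s , l = f i in
        ∈-analyticElements (slice G B) _
          -- Two equal labels in block i give equal positions with the same first component i, so
          -- their second components agree.
          (s≤s (Fin.injective⇒≤ (λ p → ,-injectiveʳ (one-one (Injection.injective U↣Fin p)))))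
          (λ j → ∈-elements U (l j))
      where U↣Fin = Bijection.injection (Inverse⇒Bijection (Symm.inverse (enumeration U)))

    -- Equality ignores the proof of linearity, so each linear orbit counts once.
    linearElements : DecSetoid 0ℓ 0ℓ
    linearElements = record
      { Carrier = Σ Outer.Carrier (Linear (set U) B)
      ; _≈_     = λ x y → proj₁ x Outer.≈ proj₁ y
      ; isDecEquivalence = record
        { isEquivalence = On.isEquivalence proj₁ Outer.isEquivalence
        ; _≟_ = λ (x , _) (y , _) →
            analytic-decidable F _ (analytic-decidable (slice G B) _ (≈-decidable U)) x y
        }
      }

    finiteLinear : FiniteSet
    finiteLinear = record
      { set         = DecSetoid.setoid linearElements
      -- The candidate equal to x is itself linear by `linear-resp-≈`, so it survives the filter.
      ; enumeration = isEnumeration⇒Inverse linearElements λ (x , linear) →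
          witnesses⁺ linear? (Any.map (λ x≈y → linear-resp-≈ x≈y linear , x≈y)
                                      (linear⇒∈-candidates linear))
      }

  -- Positions do not change and labels are composed with the bijection σ, so linearity persists.
  substitution₁ : ∀ {U U′ B B′} → U 𝔹.⇒ U′ → B 𝔹.⇒ B′ →
                  Func (set (finiteLinear U B)) (set (finiteLinear U′ B′))
  substitution₁ {U} {U′} {B} {B′} σ β = record
    { to = λ (x , linear) → outer₁ B B′ (toFunction σ) β ⟨$⟩ x
                          , Comp.bijective _≡_ (Setoid._≈_ (set U)) (Setoid._≈_ (set U′))
                              linear (Bijection.bijective (Inverse⇒Bijection σ))
    ; cong = Func.cong (outer₁ B B′ (toFunction σ) β)
    }

  -- Functoriality merges the round trip into one action by maps that are pointwise the identity.
  -- Applied also to the inverses of σ and β, it makes transport invertible.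
  outer₁-inverse : ∀ {U U′ B B′} (σ : U 𝔹.⇒ U′) (β : B 𝔹.⇒ B′) x →
    Setoid._≈_ (Outer (set U) B)
      (outer₁ B′ B (fromFunction σ) (Symm.inverse β) ⟨$⟩ (outer₁ B B′ (toFunction σ) β ⟨$⟩ x))
      x
  outer₁-inverse {U} {U′} {B} {B′} σ β x =
    Outer.trans
      (Outer.sym (outer₁-∘ B B′ B (toFunction σ) (fromFunction σ) β (Symm.inverse β) x))
    (Outer.trans
      (outer₁-cong B B (Comp.function (toFunction σ) (fromFunction σ)) (Id.function (set U))
        (𝔹._⊙_ {B} {B′} {B} (Symm.inverse β) β) (1ᴮ {B})
        (Inverse.strictlyInverseʳ σ) (Inverse.strictlyInverseʳ β) x)
      (outer₁-id (set U) B x))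
    where module Outer = Setoid (Outer (set U) B)

  substitution : Species₂
  substitution = record
    { F₀ = λ (U , B) → finiteLinear U B
    ; F₁ = λ {(U , B)} {(U′ , B′)} (σ , β) →
        let to   = substitution₁ {U} {U′} {B} {B′} σ β
            from = substitution₁ {U′} {U} {B′} {B} (Symm.inverse σ) (Symm.inverse β)
        in record
        { to        = to ⟨$⟩_
        ; from      = from ⟨$⟩_
        ; to-cong   = λ {x} {y} → Func.cong to {x} {y}
        ; from-cong = λ {x} {y} → Func.cong from {x} {y}
        ; inverse   =
            (λ {x} {y} y≈ → Setoid.trans (Outer (set U′) B′) (Func.cong to {y} {from ⟨$⟩ x} y≈)
              (outer₁-inverse {U′} {U} {B′} {B} (Symm.inverse σ) (Symm.inverse β) (proj₁ x)))
          , (λ {x} {y} y≈ → Setoid.trans (Outer (set U) B) (Func.cong from {y} {to ⟨$⟩ x} y≈)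
              (outer₁-inverse {U} {U′} {B} {B′} σ β (proj₁ x)))
        }
    ; identity = λ {(U , B)} (x , _) → outer₁-id (set U) B x
    ; homomorphism = λ {(U , B)} {(U′ , B′)} {(U″ , B″)} {(σ , β)} {(τ , γ)} (x , _) →
        outer₁-∘ B B′ B″ (toFunction σ) (toFunction τ) β γ x
    ; F-resp-≈ = λ {(U , B)} {(U′ , B′)} {(σ , β)} {(τ , γ)} (p , q) (x , _) →
        outer₁-cong B B′ (toFunction σ) (toFunction τ) β γ p q x
    }

  module _ (A : Setoid a b) where
    private module A = Setoid A

    vector : ∀ {n} → Vector A.Carrier n → Func (≡.setoid (Fin n)) A
    vector f = record { to = f ; cong = λ { refl → A.refl } }

    module _ (B : FiniteSet) where
      private
        module Outer = Setoid (Outer A B)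
        Evaluated = ∐ (Orbits (slice substitution B) A)
        module Evaluated = Setoid Evaluated

      positions : ∀ {n} ((h , _) : Carrier (set (finiteLinear [ n ] B))) → Position h ↔ Fin n
      positions (h , linear) = Bijection⇒Inverse record
        { to = label h ; cong = λ { refl → refl } ; bijective = linear }

      evaluate : Func Evaluated (Outer A B)
      evaluate = record
        { to   = λ (n , (h , _) , f) → labelled B (vector f) ⟨$⟩ h
        ; cong = λ { {n , (h , _) , f} {_ , (h′ , _) , f′} (inj refl (orbit σ p q)) →
            Outer.trans
              -- The orbit relation f ∘ σ⁻¹ = f′ is used as f = f′ ∘ σ. Labelling by f is then
              -- transport along σ followed by labelling by f′.
              (outer₁-cong B B (vector f) (Comp.function (toFunction σ) (vector f′))
                (1ᴮ {B}) (𝔹._⊙_ {B} {B} {B} (1ᴮ {B}) (1ᴮ {B}))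
                (λ i → A.trans (A.reflexive (cong f (sym (Inverse.strictlyInverseʳ σ i))))
                         (q (Inverse.to σ i)))
                (λ _ → Setoid.refl (set B)) h)
            (Outer.trans
              (outer₁-∘ B B B (toFunction σ) (vector f′) (1ᴮ {B}) (1ᴮ {B}) h)
              (Func.cong (labelled B (vector f′)) p)) }
        }

      -- Two linear elements with equal evaluations have corresponding positions,
      -- and sending label to label along this correspondence is the permutation sought.
      evaluate-injective : Injective Evaluated._≈_ Outer._≈_ (evaluate ⟨$⟩_)
      evaluate-injective {m , x@(h , _) , f} {n , y@(h′ , _) , f′} p =
        relabel (slice substitution B) A ρ
          (Setoid.trans (Outer (≡.setoid (Fin n)) B)
            (transfer (toFunction ρ) (Id.function _) λ q →
              trans (cong (Inverse.to (positions y) ∘ Inverse.from κ)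
                      (Inverse.strictlyInverseʳ (positions x) (Inverse.to κ q)))
                (cong (label h′) (Inverse.strictlyInverseʳ κ q)))
            (outer₁-id (≡.setoid (Fin n)) B h′))
          (λ i → A.trans (agree (Inverse.from (positions y) i))
                   (A.reflexive (cong f′ (Inverse.strictlyInverseˡ (positions y) i))))
        where
        matching = match B (vector f) (vector f′) p
        κ        = proj₁ matching
        agree    = proj₁ (proj₂ matching)
        transfer = proj₂ (proj₂ matching)
        ρ : Fin m ↔ Fin n
        ρ = Comp.inverse (Symm.inverse (positions x)) (Comp.inverse (Symm.inverse κ) (positions y))

      separate : Outer.Carrier → Evaluated.Carrier
      separate x@(k , t , f) =
          total (proj₁ ∘ f)
        -- The new label of a position is its number under `flatten`, so linearity is the
        -- bijectivity of π⁻¹; the old labels move into the function on `Fin`.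
        , ( (k , t , λ i → let n , s , _ = f i in n , s , λ j → Inverse.from π (i , j))
          , Bijection.bijective (Inverse⇒Bijection (Symm.inverse π)))
        , label x ∘ Inverse.to π
        where π = flatten (proj₁ ∘ f)

      evaluate-separate : ∀ x → evaluate ⟨$⟩ separate x Outer.≈ x
      evaluate-separate x@(k , t , f) = pointwise F _ (Setoid.refl (set (F.F₀ [ k ]))) λ i →
        pointwise (slice G B) A (G.identity (proj₁ (proj₂ (f i)))) λ j →
          A.reflexive (cong (label x) (Inverse.strictlyInverseˡ (flatten (proj₁ ∘ f)) (i , j)))

      evaluation : Inverse Evaluated (Outer A B)
      evaluation = Bijection⇒Inverse record
        { to        = evaluate ⟨$⟩_
        ; cong      = Func.cong evaluate
        ; bijective = evaluate-injective
                    , strictlySurjective⇒surjective Evaluated (Outer A B) (Func.cong evaluate)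
                        (λ x → separate x , evaluate-separate x)
        }

  -- Both sides act on h by the label map g ∘ f and the bijection β; the composition law factors
  -- this action in two ways.
  evaluate-natural : {A : Setoid a b} {A′ : Setoid a′ b′} (B B′ : FiniteSet)
    (g : Func A A′) (β : B 𝔹.⇒ B′) → ∀ x →
    Setoid._≈_ (Outer A′ B′)
      (evaluate A′ B′ ⟨$⟩ (analyticMap (sliceMap substitution {B} {B′} β) g ⟨$⟩ x))
      (outer₁ B B′ g β ⟨$⟩ (evaluate A B ⟨$⟩ x))
  evaluate-natural {A = A} {A′} B B′ g β (n , (h , _) , f) =
    Outer.trans (Outer.sym (outer₁-∘ B B′ B′ 1ⁿ (vector A′ g∘f) β (1ᴮ {B′}) h))
    (Outer.trans
      (outer₁-cong B B′ (Comp.function 1ⁿ (vector A′ g∘f)) (Comp.function (vector A f) g)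
        (𝔹._⊙_ {B} {B′} {B′} (1ᴮ {B′}) β) (𝔹._⊙_ {B} {B} {B′} β (1ᴮ {B}))
        (λ _ → Setoid.refl A′) (λ _ → Setoid.refl (set B′)) h)
      (outer₁-∘ B B B′ (vector A f) g (1ᴮ {B}) β h))
    where
    module Outer = Setoid (Outer A′ B′)
    1ⁿ = Id.function (≡.setoid (Fin n))
    g∘f = (g ⟨$⟩_) ∘ f

-- Since `≅P` speaks only of arguments where both functors are defined, the domains are compared
-- separately: wherever G_{X[Y]} is defined, the two sides are defined together.
lemma2p17 : ∀ {c ℓ a b s : Level} (R : CommutativeRing c ℓ) →
    (ι : ℚ → CommutativeRing.Carrier R) →
    IsRingMonomorphism +-*-rawRing (CommutativeRing.rawRing R) ι →
    (S : Summation R a b s) → let open Analytic R S in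
    (F : Species) → StrictlyFinite F → (G : Species₂) →
    Σ[ H ∈ Species₂ ]
    (∀ X → PartialFunctor.Dom (F ⟨-⟩ ∘P G X[Y]) X
    ⇔ (PartialFunctor.Dom (G X[Y]) X × PartialFunctor.Dom (H X[Y]) X))
    × (H X[Y] ≅P F ⟨-⟩ ∘P G X[Y])
lemma2p17 R ι _ S F strictlyFinite G =
    substitution
  , (λ ((A , _) , B) → mk⇔
      -- Summability of G_{X[Y]}(A, B) passes through unchanged; the outer sum is carried, with the
      -- same value r, along the weight-preserving bijection.
      (λ (d , r , sums) → d , r , reindex (Symm.inverse (iso A B)) (evaluate⁻¹-weight A B) sums)
      (λ (d , r , sums) → d , r , reindex (iso A B) (evaluate-weight A B) sums))
  , record
    { to = record
      { η       = λ (((A , _) , B) , _) → record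
          { func      = evaluate (underlying A) B
          ; preserves = evaluate-weight A B
          }
      ; commute = λ {(((A , _) , B) , _)} {(((A′ , _) , B′) , _)} (g , β) →
          evaluate-natural B B′ (WeightedMap.func g) β
      }
    ; from = λ (((A , _) , B) , _) → record
        { func      = toFunction (Symm.inverse (iso A B))
        ; preserves = evaluate⁻¹-weight A B
        }
    ; isoˡ = λ (((A , _) , B) , _) → Inverse.strictlyInverseʳ (iso A B)
    ; isoʳ = λ (((A , _) , B) , _) → Inverse.strictlyInverseˡ (iso A B)
    }
  where
  open Analytic R S
  open Summation S using (reindex)
  open Substitution F strictlyFinite G
  open WeightedSet using (underlying; weight; w)
  module R = CommutativeRing R

  iso : ∀ A B → Inverse (underlying (analytic₀ (slice substitution B) A))
                        (underlying (analytic₀ F (analytic₀ (slice G B) A)))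
  iso A B = evaluation (underlying A) B

  -- Linearity matches the positions of h with [n], so the product over positions has the same
  -- factors as the product over [n].
  evaluate-weight : ∀ A B x → w (analytic₀ F (analytic₀ (slice G B) A)) (Inverse.to (iso A B) x)
                              R.≈ w (analytic₀ (slice substitution B) A) x
  evaluate-weight A B (n , h@((_ , _ , f) , _) , l) =
    sum-reindex R.*-commutativeMonoid (proj₁ ∘ f) (positions (underlying A) B h) (w A ∘ l)

  evaluate⁻¹-weight : ∀ A B y → w (analytic₀ (slice substitution B) A) (Inverse.from (iso A B) y)
                                R.≈ w (analytic₀ F (analytic₀ (slice G B) A)) y
  evaluate⁻¹-weight A B y = R.trans
    (R.sym (evaluate-weight A B (Inverse.from (iso A B) y)))
    (Func.cong (weight (analytic₀ F (analytic₀ (slice G B) A))) (Inverse.strictlyInverseˡ (iso A B) y))
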